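{- Let $C\subseteq\mathbb{N}$ be any cohesive set. Then there is a computable linear order $\mathcal{L}$ of order-type $\omega$ such that the cohesive power $\Pi_C\mathcal{L}$ is not elementarily equivalent (and hence not isomorphic) to $\omega+\zeta\eta$.
   Context: A set $C\subseteq\mathbb{N}$ is cohesive if it is infinite and for every c.e. set $W$, either $C\setminus W$ or $C\cap W$ is finite. Write $X\subseteq^* Y$ if $X\setminus Y$ is finite. For a computable linear order $\mathcal{L}=(L,\prec_{\mathcal{L}})$ (computable domain $L\subseteq\mathbb{N}$, computable order), the cohesive power $\Pi_C\mathcal{L}$ has as elements the classes $[\varphi]$ of partial computable $\varphi\colon\mathbb{N}\to L$ with $C\subseteq^*\mathrm{dom}(\varphi)$ under $\varphi=_C\psi$ iff $C\subseteq^*\{x:\varphi(x)\downarrow=\psi(x)\downarrow\}$, ordered by $[\varphi]\prec[\psi]$ iff $C\subseteq^*\{x:\varphi(x)\downarrow,\psi(x)\downarrow,\varphi(x)\prec_{\mathcal{L}}\psi(x)\}$. Elementary equivalence is in the language $\{\prec\}$ of linear orders. $\omega,\zeta,\eta$ are the order-types of $\mathbb{N},\mathbb{Z},\mathbb{Q}$; $\zeta\eta$ means $\eta$-many copies of $\zeta$ ordered lexicographically. -}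

module Defs where

open import Data.Nat using (ℕ; zero; suc; _≤_) renaming (_<_ to _<ℕ_)
open import Data.Fin using (Fin)
open import Data.Vec using (Vec; []; _∷_; lookup)
open import Data.Maybe using (Maybe; just; nothing; _>>=_)
open import Data.Product using (Σ; ∃; _×_; _,_)
open import Data.Sum using (_⊎_; inj₁; inj₂)
open import Data.Unit using (⊤)
open import Data.Empty using (⊥)
open import Data.Integer using (ℤ) renaming (_<_ to _<ℤ_)
open import Data.Rational using (ℚ) renaming (_<_ to _<ℚ_)
open import Relation.Binary.PropositionalEquality using (_≡_)
open import Relation.Nullary using (¬_)

data Code : ℕ → Set where
  Z    : ∀ {n} → Code n
  S    : Code 1
  P    : ∀ {n} → Fin n → Code n
  Comp : ∀ {m n} → Code m → Vec (Code n) m → Code n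
  Rec  : ∀ {n} → Code n → Code (suc (suc n)) → Code (suc n)
  Mu   : ∀ {n} → Code (suc n) → Code n

mutual
  eval : ∀ {n} → ℕ → Code n → Vec ℕ n → Maybe ℕ
  eval zero    _          _        = nothing
  eval (suc k) Z          _        = just 0
  eval (suc k) S          (x ∷ []) = just (suc x)
  eval (suc k) (P i)      v        = just (lookup v i)
  eval (suc k) (Comp f g) v        = evalVec k g v >>= λ w → eval k f w
  eval (suc k) (Rec f g)  (x ∷ v)  = rec x
    where
    rec : ℕ → Maybe ℕ
    rec zero    = eval k f v
    rec (suc y) = rec y >>= λ r → eval k g (y ∷ r ∷ v)
  eval (suc k) (Mu f)     v        = search k 0
    where
    search : ℕ → ℕ → Maybe ℕ
    search zero    i = nothing
    search (suc j) i = eval k f (i ∷ v) >>= λ where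
      zero    → just i
      (suc _) → search j (suc i)

  evalVec : ∀ {m n} → ℕ → Vec (Code n) m → Vec ℕ n → Maybe (Vec ℕ m)
  evalVec k []       v = just []
  evalVec k (g ∷ gs) v = eval k g v >>= λ a → evalVec k gs v >>= λ as → just (a ∷ as)

Halts : ∀ {n} → Code n → Vec ℕ n → ℕ → Set
Halts e v y = ∃ λ k → eval k e v ≡ just y

_⟨_⟩≃_ : Code 1 → ℕ → ℕ → Set
e ⟨ x ⟩≃ y = Halts e (x ∷ []) y

Dom : Code 1 → ℕ → Set
Dom e x = ∃ λ y → e ⟨ x ⟩≃ y

Subset : Set₁
Subset = ℕ → Set

-- X ⊆* Y : X ∖ Y is finite (i.e. bounded)
_⊆*_ : Subset → Subset → Set
X ⊆* Y = ∃ λ N → ∀ x → N ≤ x → X x → Y x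

Finite : Subset → Set
Finite X = ∃ λ N → ∀ x → N ≤ x → ¬ X x

Infinite : Subset → Set
Infinite X = ∀ N → ∃ λ x → N ≤ x × X x

-- every c.e. set is the domain of some partial computable function
Cohesive : Subset → Set
Cohesive C = Infinite C ×
  (∀ (e : Code 1) → Finite (λ x → C x × ¬ Dom e x) ⊎ Finite (λ x → C x × Dom e x))

record CompOrder : Set where
  field
    domCode  : Code 1
    ordCode  : Code 2
    domTotal : ∀ x → ∃ λ y → Halts domCode (x ∷ []) y
    ordTotal : ∀ x y → ∃ λ z → Halts ordCode (x ∷ y ∷ []) z

  InL : ℕ → Set
  InL x = Halts domCode (x ∷ []) 1

  _≺_ : ℕ → ℕ → Set
  x ≺ y = Halts ordCode (x ∷ y ∷ []) 1

OrderTypeω : CompOrder → Set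
OrderTypeω L = Σ (ℕ → ℕ) λ g →
    (∀ n → InL (g n))
  × (∀ m n → (m <ℕ n → g m ≺ g n) × (g m ≺ g n → m <ℕ n))
  × (∀ x → InL x → ∃ λ n → g n ≡ x)
  where open CompOrder L

-- Structures for the language {<} (with equality interpreted by ≈)

record OrdStructure : Set₁ where
  field
    Carrier : Set
    _≈_     : Carrier → Carrier → Set
    _<_     : Carrier → Carrier → Set

data Formula (n : ℕ) : Set where
  _≐_ _⋖_     : Fin n → Fin n → Formula n
  ⊥′          : Formula n
  ¬′_         : Formula n → Formula n
  _∧′_ _∨′_ _⇒′_ : Formula n → Formula n → Formula n
  ∀′ ∃′       : Formula (suc n) → Formula n

Sentence : Set
Sentence = Formula 0

extend : ∀ {n} {A : Set} → A → (Fin n → A) → Fin (suc n) → A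
extend a ρ Fin.zero    = a
extend a ρ (Fin.suc i) = ρ i

Sat : (M : OrdStructure) → ∀ {n} → Formula n → (Fin n → OrdStructure.Carrier M) → Set
Sat M (i ≐ j) ρ = OrdStructure._≈_ M (ρ i) (ρ j)
Sat M (i ⋖ j) ρ = OrdStructure._<_ M (ρ i) (ρ j)
Sat M ⊥′      ρ = ⊥
Sat M (¬′ φ)  ρ = ¬ Sat M φ ρ
Sat M (φ ∧′ ψ) ρ = Sat M φ ρ × Sat M ψ ρ
Sat M (φ ∨′ ψ) ρ = Sat M φ ρ ⊎ Sat M ψ ρ
Sat M (φ ⇒′ ψ) ρ = Sat M φ ρ → Sat M ψ ρ
Sat M (∀′ φ)  ρ = ∀ a → Sat M φ (extend a ρ)
Sat M (∃′ φ)  ρ = ∃ λ a → Sat M φ (extend a ρ)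

_⊨_ : OrdStructure → Sentence → Set
M ⊨ φ = Sat M φ (λ ())

ElemEquiv : OrdStructure → OrdStructure → Set
ElemEquiv M N = ∀ (φ : Sentence) → (M ⊨ φ → N ⊨ φ) × (N ⊨ φ → M ⊨ φ)

CohesivePower : Subset → CompOrder → OrdStructure
CohesivePower C L = record
  { Carrier = Σ (Code 1) λ e → (C ⊆* Dom e) × (∀ x y → e ⟨ x ⟩≃ y → InL y)
  ; _≈_ = λ a b → C ⊆* (λ x → ∃ λ y → (code a ⟨ x ⟩≃ y) × (code b ⟨ x ⟩≃ y))
  ; _<_ = λ a b → C ⊆* (λ x → ∃ λ y → ∃ λ z →
                     (code a ⟨ x ⟩≃ y) × (code b ⟨ x ⟩≃ z) × y ≺ z)
  }
  where
  open CompOrder L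
  code : Σ (Code 1) (λ e → (C ⊆* Dom e) × (∀ x y → e ⟨ x ⟩≃ y → InL y)) → Code 1
  code (e , _) = e

-- The order ω + ζη : ℕ followed by ℚ-many copies of ℤ (lexicographic,
-- ℚ-coordinate first)

ωζη-lt : ℕ ⊎ (ℚ × ℤ) → ℕ ⊎ (ℚ × ℤ) → Set
ωζη-lt (inj₁ m)       (inj₁ n)       = m <ℕ n
ωζη-lt (inj₁ m)       (inj₂ _)       = ⊤
ωζη-lt (inj₂ _)       (inj₁ _)       = ⊥
ωζη-lt (inj₂ (q , a)) (inj₂ (r , b)) = q <ℚ r ⊎ (q ≡ r × a <ℤ b)

OmegaZetaEta : OrdStructure
OmegaZetaEta = record
  { Carrier = ℕ ⊎ (ℚ × ℤ)
  ; _≈_ = _≡_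
  ; _<_ = ωζη-lt
  }

{-# OPTIONS --safe #-}

-- The order consists of blocks, one after the other. Block j ends in its base element
-- π j 0, and for every machine e < j that halts on input j - 1 it contains one further
-- element, whose code includes the halting time and the final state and therefore
-- exceeds the output of e. Within a block, larger codes come first, so if machine
-- e ≤ n outputs on input n an element y above the base element of block n, then the
-- element of machine e in block n + 1 lies strictly between the two. It is computable
-- from n, so n ↦ π n 0 has no immediate successor in any power of the order, whereas
-- every element of ω + ζη has one.
--
-- Each block is finite, but enumerating the order requires deciding which machines
-- halt. This is where cohesiveness enters: "e halts on n within x + 1 steps" defines a
-- cofinite or empty set of x, and a cohesive set tells which.

module Submission where

open import Defs
open import Data.Nat
open import Data.Nat.Properties
open import Data.Fin as Fin using (Fin; #_; toℕ)
import Data.Fin.Properties as Fin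
import Data.Integer as ℤ
import Data.Integer.Properties as ℤ
import Data.Rational.Properties as ℚ
open import Data.Empty using (⊥-elim)
open import Data.List using (List; []; _∷_)
open import Data.Maybe using (Maybe; just; _>>=_)
open import Data.Maybe.Properties using (just-injective)
open import Data.Product using (Σ; ∃; _×_; _,_; proj₁; proj₂)
open import Data.Sum using (_⊎_; inj₁; inj₂)
open import Data.Vec using (Vec; []; _∷_; lookup)
open import Relation.Binary using (tri<; tri≈; tri>)
open import Relation.Binary.PropositionalEquality
open import Relation.Nullary using (¬_; Dec; yes; no)
open import Relation.Nullary.Decidable using (_×-dec_)

-- Auxiliary facts about bounds

<-suc-elim : ∀ {P : ℕ → Set} {n} → (∀ i → i < n → P i) → P n → ∀ i → i < suc n → P i
<-suc-elim below pn i (s≤s i≤n) with m≤n⇒m<n∨m≡n i≤n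
... | inj₁ i<n  = below i i<n
... | inj₂ refl = pn

bounded-max : (ℕ → ℕ) → ℕ → ℕ
bounded-max f zero    = 0
bounded-max f (suc n) = bounded-max f n ⊔ f n

≤-bounded-max : ∀ f {i n} → i < n → f i ≤ bounded-max f n
≤-bounded-max f {i} {suc n} (s≤s i≤n) with m≤n⇒m<n∨m≡n i≤n
... | inj₁ i<n  = ≤-trans (≤-bounded-max f i<n) (m≤m⊔n _ _)
... | inj₂ refl = m≤n⊔m _ _

-- Evaluation of codes

>>=-just : ∀ {A B : Set} (m : Maybe A) {f : A → Maybe B} {y} →
           (m >>= f) ≡ just y → ∃ λ a → m ≡ just a × f a ≡ just y
>>=-just (just a) eq = a , refl , eq

-- `searchMu` is the local function `search` of `eval`, and `stepRec … x` is its
-- local `rec` at `suc x`. They have no name outside `Defs`; unification recovers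
-- them once abstraction has made their arguments distinct variables.
mutual
  searchMu : ∀ {n} → ℕ → Code (suc n) → Vec ℕ n → ℕ → ℕ → Maybe ℕ
  searchMu = _

  searchMu-solution : ∀ {n} k (f : Code (suc n)) v m → eval (suc k) f (0 ∷ v) ≡ just (suc m) →
    eval (suc (suc k)) (Mu f) v ≡ searchMu (suc k) f v k 1
  searchMu-solution k f v m eq rewrite eq with suc k | 1
  ... | _ | _ = refl

mutual
  stepRec : ∀ {n} → ℕ → Code n → Code (suc (suc n)) → ℕ → Vec ℕ n → ℕ → Maybe ℕ
  stepRec = _

  stepRec-solution : ∀ {n} k (f : Code n) g x v →
    eval (suc k) (Rec f g) (suc x ∷ v) ≡ stepRec k f g (suc x) v x
  stepRec-solution k f g x v with suc x
  ... | _ = refl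

-- The local `rec` also captures the recursion argument, without using it.
stepRec-captured : ∀ {n} k (f : Code n) g x x′ v y → stepRec k f g x v y ≡ stepRec k f g x′ v y
stepRec-captured k f g x x′ v zero = refl
stepRec-captured k f g x x′ v (suc y) = cong (_>>= _) (stepRec-captured k f g x x′ v y)

eval-Rec-suc : ∀ {n} k (f : Code n) g x v → eval (suc k) (Rec f g) (suc x ∷ v) ≡
  (eval (suc k) (Rec f g) (x ∷ v) >>= λ r → eval k g (x ∷ r ∷ v))
eval-Rec-suc k f g x v = stepRec-captured k f g (suc x) x v x

mutual
  eval-mono : ∀ {n k k′ y} → k ≤ k′ → (c : Code n) (v : Vec ℕ n) →
              eval k c v ≡ just y → eval k′ c v ≡ just y
  eval-mono (s≤s p) Z v eq = eq
  eval-mono (s≤s p) S (x ∷ []) eq = eq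
  eval-mono (s≤s p) (P i) v eq = eq
  eval-mono {k = suc k} (s≤s p) (Comp f gs) v eq with >>=-just (evalVec k gs v) eq
  ... | w , e₁ , e₂ rewrite evalVec-mono p gs v e₁ = eval-mono p f w e₂
  eval-mono (s≤s p) (Rec f g) (x ∷ v) eq = Rec-mono p f g v x eq
  eval-mono (s≤s p) (Mu f) v eq = searchMu-mono p f v p 0 eq

  Rec-mono : ∀ {n k k′ y} → k ≤ k′ → (f : Code n) (g : Code (suc (suc n))) (v : Vec ℕ n) → ∀ x →
             eval (suc k) (Rec f g) (x ∷ v) ≡ just y → eval (suc k′) (Rec f g) (x ∷ v) ≡ just y
  Rec-mono p f g v zero eq = eval-mono p f v eq
  Rec-mono {k = k} p f g v (suc x) eq
    with >>=-just (eval (suc k) (Rec f g) (x ∷ v)) (trans (sym (eval-Rec-suc k f g x v)) eq)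
  ... | r , e₁ , e₂ = trans (eval-Rec-suc _ f g x v)
    (trans (cong (_>>= _) (Rec-mono p f g v x e₁)) (eval-mono p g (x ∷ r ∷ v) e₂))

  evalVec-mono : ∀ {m n k k′ w} → k ≤ k′ → (gs : Vec (Code n) m) (v : Vec ℕ n) →
                 evalVec k gs v ≡ just w → evalVec k′ gs v ≡ just w
  evalVec-mono p [] v eq = eq
  evalVec-mono {k = k} p (g ∷ gs) v eq with >>=-just (eval k g v) eq
  ... | a , e₁ , eq′ with >>=-just (evalVec k gs v) eq′
  ... | as , e₂ , e₃ rewrite eval-mono p g v e₁ | evalVec-mono p gs v e₂ = e₃

  -- `eval` uses one number both as fuel for the body and as limit on the trials. The induction
  -- consumes only the limit, so the two are treated separately.
  searchMu-mono : ∀ {n k k′ j j′ y} → k ≤ k′ → (f : Code (suc n)) (v : Vec ℕ n) → j ≤ j′ → ∀ i →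
                  searchMu k f v j i ≡ just y → searchMu k′ f v j′ i ≡ just y
  searchMu-mono {k = k} p f v (s≤s q) i eq with eval k f (i ∷ v) in e
  searchMu-mono p f v (s≤s q) i eq | just zero
    rewrite eval-mono p f (i ∷ v) e = eq
  searchMu-mono p f v (s≤s q) i eq | just (suc _)
    rewrite eval-mono p f (i ∷ v) e = searchMu-mono p f v q (suc i) eq

Halts-deterministic : ∀ {n} {c : Code n} {v a b} → Halts c v a → Halts c v b → a ≡ b
Halts-deterministic {c = c} {v} (k , p) (l , q) = just-injective
  (trans (sym (eval-mono (m≤m⊔n k l) c v p)) (eval-mono (m≤n⊔m k l) c v q))

-- A record rather than a Σ-type: `evalVec` reduces on its vector of codes, so unification could not
-- recover `gs` and `v` from an unfolded type.
record HaltsVec {m n} (gs : Vec (Code n) m) (v : Vec ℕ n) (w : Vec ℕ m) : Set where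
  constructor _,_
  field
    fuel     : ℕ
    evalVec≡ : evalVec fuel gs v ≡ just w

HaltsVec-[] : ∀ {n} {v : Vec ℕ n} → HaltsVec [] v []
HaltsVec-[] = 0 , refl

HaltsVec-∷ : ∀ {m n} {g} {gs : Vec (Code n) m} {v a as} →
             Halts g v a → HaltsVec gs v as → HaltsVec (g ∷ gs) v (a ∷ as)
HaltsVec-∷ {g = g} {gs} {v} (k , p) (l , q) = k ⊔ l , lemma
  where
  lemma : evalVec (k ⊔ l) (g ∷ gs) v ≡ just (_ ∷ _)
  lemma rewrite eval-mono (m≤m⊔n k l) g v p | evalVec-mono (m≤n⊔m k l) gs v q = refl

Comp-halts : ∀ {m n} {f} {gs : Vec (Code n) m} {v w y} →
             HaltsVec gs v w → Halts f w y → Halts (Comp f gs) v y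
Comp-halts {f = f} {gs} {v} {w} {y} (k , p) (l , q) = suc (k ⊔ l) , lemma
  where
  lemma : eval (suc (k ⊔ l)) (Comp f gs) v ≡ just y
  lemma rewrite evalVec-mono (m≤m⊔n k l) gs v p = eval-mono (m≤n⊔m k l) f w q

Comp-halts⁻ : ∀ {m n} {f} {gs : Vec (Code n) m} {v y} →
              Halts (Comp f gs) v y → ∃ λ w → HaltsVec gs v w × Halts f w y
Comp-halts⁻ {gs = gs} {v} (suc k , eq) with >>=-just (evalVec k gs v) eq
... | w , e₁ , e₂ = w , (k , e₁) , (k , e₂)

HaltsVec-∷⁻ : ∀ {m n} {g} {gs : Vec (Code n) m} {v w} →
              HaltsVec (g ∷ gs) v w → ∃ λ a → Halts g v a
HaltsVec-∷⁻ {g = g} {v = v} (k , eq) with >>=-just (eval k g v) eq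
... | a , e , _ = a , k , e

Rec-halts-zero : ∀ {n} {f : Code n} {g v y} → Halts f v y → Halts (Rec f g) (0 ∷ v) y
Rec-halts-zero (k , p) = suc k , p

Rec-halts-suc : ∀ {n} {f : Code n} {g x v r y} →
  Halts (Rec f g) (x ∷ v) r → Halts g (x ∷ r ∷ v) y → Halts (Rec f g) (suc x ∷ v) y
Rec-halts-suc {f = f} {g} {x} {v} {r} {y} (k , p) (l , q) = suc (k ⊔ l) ,
  trans (eval-Rec-suc (k ⊔ l) f g x v)
    (trans (cong (_>>= _) (eval-mono (m≤n⇒m≤1+n (m≤m⊔n k l)) (Rec f g) (x ∷ v) p))
           (eval-mono (m≤n⊔m k l) g (x ∷ r ∷ v) q))

Mu-halts⁻ : ∀ {n} {f : Code (suc n)} {v y} → Halts (Mu f) v y →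
  Halts f (y ∷ v) 0 × (∀ i → i < y → ∃ λ m → Halts f (i ∷ v) (suc m))
Mu-halts⁻ {f = f} {v} (suc k , eq) = go k 0 (λ _ ()) eq
  where
  Nonzero : ℕ → Set
  Nonzero i = ∃ λ m → Halts f (i ∷ v) (suc m)

  go : ∀ {y} j i → (∀ i′ → i′ < i → Nonzero i′) → searchMu k f v j i ≡ just y →
       Halts f (y ∷ v) 0 × (∀ i → i < y → Nonzero i)
  go (suc j) i below eq with eval k f (i ∷ v) in e
  go (suc j) i below refl | just zero    = (k , e) , below
  go (suc j) i below eq   | just (suc m) = go j (suc i) (<-suc-elim below (m , k , e)) eq

module _ {n} {f : Code (suc n)} {v : Vec ℕ n} (h : ℕ → ℕ)
         (f-halts : ∀ i → Halts f (i ∷ v) (h i)) where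

  Mu-halts : ∀ t → h t ≡ 0 → ∃ λ y → Halts (Mu f) v y
  Mu-halts t ht≡0 = proj₁ found , suc k , proj₂ found
    where
    fuel : ℕ → ℕ
    fuel i = proj₁ (f-halts i)

    k : ℕ
    -- `k` must cover the fuel of the trials 0, ..., `t` and also their number `suc t`.
    k = bounded-max fuel (suc t) ⊔ suc t

    eval-f : ∀ i → i ≤ t → eval k f (i ∷ v) ≡ just (h i)
    eval-f i i≤t = eval-mono (≤-trans (≤-bounded-max fuel (s≤s i≤t)) (m≤m⊔n _ (suc t))) f (i ∷ v)
                     (proj₂ (f-halts i))

    -- The invariant `t < j + i` says that the remaining `j` trials still reach the zero at `t`; the
    -- search may stop at an earlier zero.
    search : ∀ j i → i ≤ t → t < j + i → ∃ λ y → searchMu k f v j i ≡ just y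
    search zero i i≤t t<i = ⊥-elim (<⇒≱ t<i i≤t)
    search (suc j) i i≤t t<j+i rewrite eval-f i i≤t with h i in e
    ... | zero = i , refl
    ... | suc _ = search j (suc i) (≤∧≢⇒< i≤t λ { refl → 0≢1+n (trans (sym ht≡0) e) })
                    (subst (t <_) (sym (+-suc j i)) t<j+i)

    found : ∃ λ y → searchMu k f v k 0 ≡ just y
    found = search k 0 z≤n (subst (t <_) (sym (+-identityʳ k)) (m≤n⊔m (bounded-max fuel (suc t)) (suc t)))

-- Total computable functions

-- A function is kept together with a code and a proof that the code computes it, so that every
-- expression in the combinators below is computable by construction.
record Fn (n : ℕ) : Set where
  field
    fn    : Vec ℕ n → ℕ
    code  : Code n
    halts : ∀ v → Halts code v (fn v)

open Fn

Halts⇒fn : ∀ {n} (F : Fn n) {v y} → Halts (code F) v y → fn F v ≡ y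
Halts⇒fn F {v} = Halts-deterministic (halts F v)

fn⇒Halts : ∀ {n} (F : Fn n) {v y} → fn F v ≡ y → Halts (code F) v y
fn⇒Halts F {v} refl = halts F v

var : ∀ {n} → Fin n → Fn n
var i = record { fn = λ v → lookup v i ; code = P i ; halts = λ v → 1 , refl }

codes : ∀ {m n} → Vec (Fn n) m → Vec (Code n) m
codes []       = []
codes (G ∷ Gs) = code G ∷ codes Gs

values : ∀ {m n} → Vec (Fn n) m → Vec ℕ n → Vec ℕ m
values []       v = []
values (G ∷ Gs) v = fn G v ∷ values Gs v

codes-halt : ∀ {m n} (Gs : Vec (Fn n) m) v → HaltsVec (codes Gs) v (values Gs v)
codes-halt [] v = HaltsVec-[]
codes-halt (G ∷ Gs) v = HaltsVec-∷ (halts G v) (codes-halt Gs v)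

infixl 9 _$_
_$_ : ∀ {m n} → Fn m → Vec (Fn n) m → Fn n
F $ Gs = record
  { fn    = λ v → fn F (values Gs v)
  ; code  = Comp (code F) (codes Gs)
  ; halts = λ v → Comp-halts (codes-halt Gs v) (halts F (values Gs v))
  }

sucF : ∀ {n} → Fn n → Fn n
sucF G = record
  { fn    = λ v → suc (fn G v)
  ; code  = Comp S (code G ∷ [])
  ; halts = λ v → Comp-halts (HaltsVec-∷ (halts G v) HaltsVec-[]) (1 , refl)
  }

const : ∀ {n} → ℕ → Fn n
const zero    = record { fn = λ _ → 0 ; code = Z ; halts = λ v → 1 , refl }
const (suc m) = sucF (const m)

fn-const : ∀ {n} m (v : Vec ℕ n) → fn (const m) v ≡ m
fn-const zero v = refl
fn-const (suc m) v = cong suc (fn-const m v)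

primRec : ∀ {n} → (Vec ℕ n → ℕ) → (Vec ℕ (suc (suc n)) → ℕ) → ℕ → Vec ℕ n → ℕ
primRec f g zero    v = f v
primRec f g (suc x) v = g (x ∷ primRec f g x v ∷ v)

recF : ∀ {n} → Fn n → Fn (suc (suc n)) → Fn (suc n)
recF {n} F G = record
  { fn    = λ { (x ∷ v) → primRec (fn F) (fn G) x v }
  ; code  = Rec (code F) (code G)
  ; halts = λ { (x ∷ v) → Rec-halts x v }
  }
  where
  Rec-halts : ∀ x v → Halts (Rec (code F) (code G)) (x ∷ v) (primRec (fn F) (fn G) x v)
  Rec-halts zero v = Rec-halts-zero {f = code F} {code G} (halts F v)
  Rec-halts (suc x) v = Rec-halts-suc (Rec-halts x v) (halts G _)

-- The code is retained while its function is replaced by a pointwise equal one. This keeps `fn` in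
-- the form of ordinary arithmetic instead of nested `primRec`.
respec₁ : (F : Fn 1) (h : ℕ → ℕ) → (∀ x → fn F (x ∷ []) ≡ h x) → Fn 1
respec₁ F h eq = record
  { fn    = λ { (x ∷ []) → h x }
  ; code  = code F
  ; halts = λ { (x ∷ []) → fn⇒Halts F (eq x) }
  }

respec₂ : (F : Fn 2) (h : ℕ → ℕ → ℕ) → (∀ x y → fn F (x ∷ y ∷ []) ≡ h x y) → Fn 2
respec₂ F h eq = record
  { fn    = λ { (x ∷ y ∷ []) → h x y }
  ; code  = code F
  ; halts = λ { (x ∷ y ∷ []) → fn⇒Halts F (eq x y) }
  }

respec₃ : (F : Fn 3) (h : ℕ → ℕ → ℕ → ℕ) → (∀ x y z → fn F (x ∷ y ∷ z ∷ []) ≡ h x y z) → Fn 3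
respec₃ F h eq = record
  { fn    = λ { (x ∷ y ∷ z ∷ []) → h x y z }
  ; code  = code F
  ; halts = λ { (x ∷ y ∷ z ∷ []) → fn⇒Halts F (eq x y z) }
  }

predF : ∀ {n} → Fn n → Fn n
predF G = respec₁ (recF (const 0) (var (# 0))) pred (λ { zero → refl ; (suc x) → refl }) $ (G ∷ [])

infixl 6 _⊕_ _⊖_
infixl 7 _⊗_

_⊕_ : ∀ {n} → Fn n → Fn n → Fn n
F ⊕ G = respec₂ add _+_ spec $ (F ∷ G ∷ [])
  where
  add : Fn 2
  add = recF (var (# 0)) (sucF (var (# 1)))
  spec : ∀ x y → fn add (x ∷ y ∷ []) ≡ x + y
  spec zero y = refl
  spec (suc x) y = cong suc (spec x y)

_⊗_ : ∀ {n} → Fn n → Fn n → Fn n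
F ⊗ G = respec₂ mul _*_ spec $ (F ∷ G ∷ [])
  where
  mul : Fn 2
  mul = recF (const 0) (var (# 2) ⊕ var (# 1))
  spec : ∀ x y → fn mul (x ∷ y ∷ []) ≡ x * y
  spec zero y = refl
  spec (suc x) y = cong (y +_) (spec x y)

_⊖_ : ∀ {n} → Fn n → Fn n → Fn n
F ⊖ G = respec₂ sub (λ x y → y ∸ x) spec $ (G ∷ F ∷ [])
  where
  sub : Fn 2
  sub = recF (var (# 0)) (predF (var (# 1)))
  spec : ∀ x y → fn sub (x ∷ y ∷ []) ≡ y ∸ x
  spec zero y = refl
  spec (suc x) y = trans (cong pred (spec x y)) (pred[m∸n]≡m∸[1+n] y x)

-- Case distinction, integer square root and pairing

ifz : ℕ → ℕ → ℕ → ℕ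
ifz zero    a b = a
ifz (suc _) a b = b

ifzF : ∀ {n} → Fn n → Fn n → Fn n → Fn n
ifzF F G H = respec₃ (recF (var (# 0)) (var (# 3))) ifz
  (λ { zero y z → refl ; (suc x) y z → refl }) $ (F ∷ G ∷ H ∷ [])

-- The integer part of the root: at `suc x` it grows by 1 exactly if the truncated difference is 0,
-- that is, if the next square is at most `suc x`.
sqrt : ℕ → ℕ
sqrt zero    = 0
sqrt (suc x) = ifz (suc (sqrt x) * suc (sqrt x) ∸ suc x) (suc (sqrt x)) (sqrt x)

sqrt-spec : ∀ x → sqrt x * sqrt x ≤ x × x < suc (sqrt x) * suc (sqrt x)
sqrt-spec zero = z≤n , s≤s z≤n
sqrt-spec (suc x) with sqrt x | sqrt-spec x
... | r | r²≤x , x<r₁² with suc r * suc r ∸ suc x in e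
... | zero  = m∸n≡0⇒m≤n e , ≤-<-trans x<r₁² (*-mono-< (n<1+n (suc r)) (n<1+n (suc r)))
... | suc _ = m≤n⇒m≤1+n r²≤x ,
  m∸n≢0⇒n<m λ e′ → 0≢1+n (trans (sym e′) e)

sqrt-unique : ∀ {x r} → r * r ≤ x → x < suc r * suc r → sqrt x ≡ r
sqrt-unique {x} {r} r²≤x x<r₁² with sqrt-spec x
... | s²≤x , x<s₁² = ≤-antisym (below s²≤x x<r₁²) (below r²≤x x<s₁²)
  where
  below : ∀ {m n} → m * m ≤ x → x < suc n * suc n → m ≤ n
  below {m} {n} m²≤x x<n₁² with m ≤? n
  ... | yes m≤n = m≤n
  ... | no m≰n = ⊥-elim (<⇒≱ x<n₁² (≤-trans (*-mono-≤ (≰⇒> m≰n) (≰⇒> m≰n)) m²≤x))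

sqrtF : ∀ {n} → Fn n → Fn n
sqrtF G = respec₁ F sqrt spec $ (G ∷ [])
  where
  r₁ = sucF (var {2} (# 1))
  F : Fn 1
  F = recF (const 0) (ifzF (r₁ ⊗ r₁ ⊖ sucF (var (# 0))) r₁ (var (# 1)))
  spec : ∀ x → fn F (x ∷ []) ≡ sqrt x
  spec zero = refl
  spec (suc x) rewrite spec x = refl

m≤m*m : ∀ m → m ≤ m * m
m≤m*m zero      = z≤n
m≤m*m m@(suc _) = m≤m*n m m

-- An injection ℕ² → ℕ, monotone in both arguments but not surjective: `fst` and
-- `snd` are meaningful on its image only.
opaque
  π : ℕ → ℕ → ℕ
  π a b = (a + b) * (a + b) + a

  fst snd : ℕ → ℕ
  fst x = x ∸ sqrt x * sqrt x
  snd x = sqrt x ∸ fst x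

  private
    -- The summand `a` is at most `a + b`, hence too small to reach the next square.
    sqrt-π : ∀ a b → sqrt (π a b) ≡ a + b
    sqrt-π a b = sqrt-unique (m≤m+n _ a) (begin-strict
      r * r + a           ≤⟨ +-monoʳ-≤ (r * r) (m≤m+n a b) ⟩
      r * r + r           ≡⟨ +-comm (r * r) r ⟩
      suc r * r           <⟨ *-monoʳ-< (suc r) (n<1+n r) ⟩
      suc r * suc r       ∎)
      where
      open ≤-Reasoning
      r : ℕ
      r = a + b

  fst-π : ∀ a b → fst (π a b) ≡ a
  fst-π a b rewrite sqrt-π a b = m+n∸m≡n ((a + b) * (a + b)) a

  snd-π : ∀ a b → snd (π a b) ≡ b
  snd-π a b = trans (cong₂ _∸_ (sqrt-π a b) (fst-π a b)) (m+n∸m≡n a b)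

  π-mono : ∀ {a a′ b b′} → a ≤ a′ → b ≤ b′ → π a b ≤ π a′ b′
  π-mono p q = +-mono-≤ (*-mono-≤ (+-mono-≤ p q) (+-mono-≤ p q)) p

  m≤πmn : ∀ m n → m ≤ π m n
  m≤πmn m n = m≤n+m m _

  n≤πmn : ∀ m n → n ≤ π m n
  n≤πmn m n = ≤-trans (≤-trans (m≤n+m n m) (m≤m*m (m + n))) (m≤m+n _ m)

  snd-≤ : ∀ x → snd x ≤ x
  snd-≤ x = ≤-trans (m∸n≤m (sqrt x) (fst x)) (≤-trans (m≤m*m (sqrt x)) (proj₁ (sqrt-spec x)))

  -- Outside the block `π`, `fst` and `snd` do not unfold; this equation and the next two link them
  -- to the codes in `πF`, `fstF` and `sndF`.
  π-def : ∀ a b → (a + b) * (a + b) + a ≡ π a b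
  π-def a b = refl

  fst-def : ∀ x → x ∸ sqrt x * sqrt x ≡ fst x
  fst-def x = refl

  snd-def : ∀ x → sqrt x ∸ fst x ≡ snd x
  snd-def x = refl

πF : ∀ {n} → Fn n → Fn n → Fn n
πF F G = respec₂ ((var (# 0) ⊕ var (# 1)) ⊗ (var (# 0) ⊕ var (# 1)) ⊕ var (# 0)) π π-def $ (F ∷ G ∷ [])

fstF : ∀ {n} → Fn n → Fn n
fstF F = respec₁ (var (# 0) ⊖ sqrtF (var (# 0)) ⊗ sqrtF (var (# 0))) fst fst-def $ (F ∷ [])

sndF : ∀ {n} → Fn n → Fn n
sndF F = respec₁ (sqrtF (var (# 0)) ⊖ fstF (var (# 0))) snd snd-def $ (F ∷ [])

-- A universal machine

infixr 6 _⨾_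

data Prog : Set where
  op    : ℕ → Prog
  _⨾_   : Prog → Prog → Prog
  while : Prog → Prog

⌜_⌝ : Prog → ℕ
⌜ op i ⌝    = π 0 i
⌜ p ⨾ q ⌝   = π 1 (π ⌜ p ⌝ ⌜ q ⌝)
⌜ while p ⌝ = π 2 ⌜ p ⌝

⌜_⌝* : List Prog → ℕ
⌜ [] ⌝*     = 0
⌜ p ∷ ps ⌝* = suc (π ⌜ p ⌝ ⌜ ps ⌝*)

config : List Prog → ℕ → ℕ
config ps s = π ⌜ ps ⌝* s

-- A configuration is a stack of programs still to be executed together with a
-- state, of which `while` tests the first component.
module Machine (execF : Fn 2) where

  exec : ℕ → ℕ → ℕ
  exec i s = fn execF (i ∷ s ∷ [])

  stepF : Fn 1
  -- The cases in order: the empty stack, where the configuration stays fixed; `op`; `⨾`, which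
  -- becomes two stack entries; `while`.
  stepF = ifzF todo (var (# 0))
    (ifzF tag (πF rest (execF $ (arg ∷ state ∷ [])))
    (ifzF (predF tag) (πF (sucF (πF (fstF arg) (sucF (πF (sndF arg) rest)))) state)
    (ifzF (fstF state) (πF rest state) (πF (sucF (πF arg todo)) state))))
    where
    todo state top rest tag arg : Fn 1
    todo  = fstF (var (# 0))
    state = sndF (var (# 0))
    top   = fstF (predF todo)
    rest  = sndF (predF todo)
    tag   = fstF top
    arg   = sndF top

  opaque
    step : ℕ → ℕ
    step c = fn stepF (c ∷ [])

    step-op : ∀ i ps s → step (config (op i ∷ ps) s) ≡ config ps (exec i s)
    step-op i ps s
      rewrite fst-π ⌜ op i ∷ ps ⌝* s | snd-π ⌜ op i ∷ ps ⌝* s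
            | fst-π ⌜ op i ⌝ ⌜ ps ⌝* | snd-π ⌜ op i ⌝ ⌜ ps ⌝*
            | fst-π 0 i | snd-π 0 i = refl

    step-⨾ : ∀ p q ps s → step (config (p ⨾ q ∷ ps) s) ≡ config (p ∷ q ∷ ps) s
    step-⨾ p q ps s
      rewrite fst-π ⌜ p ⨾ q ∷ ps ⌝* s | snd-π ⌜ p ⨾ q ∷ ps ⌝* s
            | fst-π ⌜ p ⨾ q ⌝ ⌜ ps ⌝* | snd-π ⌜ p ⨾ q ⌝ ⌜ ps ⌝*
            | fst-π 1 (π ⌜ p ⌝ ⌜ q ⌝) | snd-π 1 (π ⌜ p ⌝ ⌜ q ⌝)
            | fst-π ⌜ p ⌝ ⌜ q ⌝ | snd-π ⌜ p ⌝ ⌜ q ⌝ = refl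

    step-while-zero : ∀ p ps s → fst s ≡ 0 → step (config (while p ∷ ps) s) ≡ config ps s
    step-while-zero p ps s s≡0
      rewrite fst-π ⌜ while p ∷ ps ⌝* s | snd-π ⌜ while p ∷ ps ⌝* s
            | fst-π ⌜ while p ⌝ ⌜ ps ⌝* | snd-π ⌜ while p ⌝ ⌜ ps ⌝*
            | fst-π 2 ⌜ p ⌝ | s≡0 = refl

    step-while-suc : ∀ p ps s {m} → fst s ≡ suc m →
                     step (config (while p ∷ ps) s) ≡ config (p ∷ while p ∷ ps) s
    step-while-suc p ps s s≡1+m
      rewrite fst-π ⌜ while p ∷ ps ⌝* s | snd-π ⌜ while p ∷ ps ⌝* s
            | fst-π ⌜ while p ⌝ ⌜ ps ⌝* | snd-π ⌜ while p ⌝ ⌜ ps ⌝*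
            | fst-π 2 ⌜ p ⌝ | snd-π 2 ⌜ p ⌝ | s≡1+m = refl

    step-halted : ∀ c → fst c ≡ 0 → step c ≡ c
    step-halted c c≡0 rewrite c≡0 = refl

    run : ℕ → ℕ → ℕ
    run zero    c = c
    run (suc t) c = step (run t c)

    run-def : ∀ t c → primRec (λ v → lookup v (# 0)) (λ v → fn stepF (lookup v (# 1) ∷ [])) t (c ∷ []) ≡ run t c
    run-def zero c = refl
    run-def (suc t) c = cong step (run-def t c)

    run-zero : ∀ c → run 0 c ≡ c
    run-zero c = refl

    run-+ : ∀ s t c → run (s + t) c ≡ run s (run t c)
    run-+ zero t c = refl
    run-+ (suc s) t c = cong step (run-+ s t c)

    run-halted : ∀ s c → fst c ≡ 0 → run s c ≡ c
    run-halted zero c c≡0 = refl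
    run-halted (suc s) c c≡0 = trans (cong step (run-halted s c c≡0)) (step-halted c c≡0)

    run-halted-≤ : ∀ {s t} c → s ≤ t → fst (run s c) ≡ 0 → run t c ≡ run s c
    run-halted-≤ {s} {t} c s≤t h = trans (cong (λ u → run u c) (sym (m∸n+n≡m s≤t)))
      (trans (run-+ (t ∸ s) s c) (run-halted (t ∸ s) (run s c) h))

    infix 4 _⟶*_
    _⟶*_ : ℕ → ℕ → Set
    c ⟶* c′ = ∃ λ t → run t c ≡ c′

    ⟶*-trans : ∀ {a b c} → a ⟶* b → b ⟶* c → a ⟶* c
    ⟶*-trans {a} (t , refl) (s , refl) = s + t , run-+ s t a

    -- Quantifying over the pending programs `ps` lets executions be composed: `p` in `p ⨾ q` runs
    -- with `q` pending, a loop body with its loop pending.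
    Runs : Prog → ℕ → ℕ → Set
    Runs p s s′ = ∀ ps → config (p ∷ ps) s ⟶* config ps s′

    Runs-op : ∀ i {s s′} → exec i s ≡ s′ → Runs (op i) s s′
    Runs-op i {s} refl ps = 1 , step-op i ps s

    Runs-⨾ : ∀ {p q s s′ s″} → Runs p s s′ → Runs q s′ s″ → Runs (p ⨾ q) s s″
    Runs-⨾ {p} {q} {s} h h′ ps =
      ⟶*-trans (1 , step-⨾ p q ps s) (⟶*-trans (h (q ∷ ps)) (h′ ps))

    Runs-while-zero : ∀ p {s} → fst s ≡ 0 → Runs (while p) s s
    Runs-while-zero p {s} s≡0 ps = 1 , step-while-zero p ps s s≡0

    Runs-while-suc : ∀ {p s s′ s″ m} → fst s ≡ suc m → Runs p s s′ → Runs (while p) s′ s″ →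
                     Runs (while p) s s″
    Runs-while-suc {p} {s} s≡1+m h h′ ps =
      ⟶*-trans (1 , step-while-suc p ps s s≡1+m) (⟶*-trans (h (while p ∷ ps)) (h′ ps))

    Runs⇒run : ∀ {p s s′} → Runs p s s′ → ∃ λ t → run t (config (p ∷ []) s) ≡ config [] s′
    Runs⇒run h = h []

  runF : ∀ {n} → Fn n → Fn n → Fn n
  runF F G = respec₂ (recF (var (# 0)) (stepF $ (var (# 1) ∷ []))) run run-def $ (F ∷ G ∷ [])

dispatch : List (Fn 1) → ℕ → ℕ → ℕ
dispatch []       i       s = s
dispatch (F ∷ Fs) zero    s = fn F (s ∷ [])
dispatch (F ∷ Fs) (suc i) s = dispatch Fs i s

dispatchF : List (Fn 1) → Fn 2
dispatchF Fs = respec₂ (go Fs) (dispatch Fs) (spec Fs)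
  where
  go : List (Fn 1) → Fn 2
  go []       = var (# 1)
  go (F ∷ Fs) = ifzF (var (# 0)) (F $ (var (# 1) ∷ [])) (go Fs $ (predF (var (# 0)) ∷ var (# 1) ∷ []))

  spec : ∀ Fs i s → fn (go Fs) (i ∷ s ∷ []) ≡ dispatch Fs i s
  spec []       i       s = refl
  spec (F ∷ Fs) zero    s = refl
  spec (F ∷ Fs) (suc i) s = spec Fs i s

-- The state π a (π b …) represents a stack with a on top.
private
  s₀ h₀ t₀ : Fn 1
  s₀ = var (# 0)
  h₀ = fstF s₀
  t₀ = sndF s₀

operations : List (Fn 1)
operations =
    πF (const 0) t₀
  ∷ πF (sucF (fstF h₀)) t₀
  ∷ πF (fstF h₀) t₀
  ∷ πF (sndF h₀) t₀
  ∷ πF h₀ s₀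
  ∷ πF (fstF t₀) (πF h₀ (sndF t₀))
  ∷ πF (πF h₀ (fstF t₀)) (sndF t₀)
  ∷ πF (sndF h₀) (πF (fstF h₀) (πF (const 0) (πF (sndF h₀) t₀)))
  ∷ πF (πF (fstF t₀) (πF (fstF (sndF t₀)) (fstF (sndF (sndF t₀)))))
       (πF (predF h₀) (πF (sucF (fstF t₀)) (sndF (sndF t₀))))
  ∷ πF (fstF t₀) (πF (fstF (sndF t₀)) (πF h₀ (sndF (sndF t₀))))
  ∷ πF (fstF (sndF t₀)) (sndF (sndF (sndF t₀)))
  ∷ πF (const 1) (πF (const 0) s₀)
  ∷ πF (πF (fstF t₀) (fstF (sndF t₀))) (πF (sucF (fstF t₀)) (sndF t₀))
  ∷ πF (predF (fstF t₀)) (sndF (sndF t₀))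
  ∷ []

-- Opaque because its normal form is too large to occur in goals about `Runs`.
opaque
  operationsF : Fn 2
  operationsF = dispatchF operations

open Machine operationsF

-- Compilation of codes into stack programs

setZero increment head tail dup swap cons recInit recBody recNext recEnd muInit muBody muEnd : Prog
setZero   = op 0
increment = op 1
head      = op 2
tail      = op 3
dup       = op 4
swap      = op 5
cons      = op 6
recInit   = op 7
recBody   = op 8
recNext   = op 9
recEnd    = op 10
muInit    = op 11
muBody    = op 12
muEnd     = op 13

compileVar : ∀ {n} → Fin n → Prog
compileVar Fin.zero    = head
compileVar (Fin.suc i) = tail ⨾ compileVar i

mutual
  -- A compiled code replaces the coded argument vector on top of the stack by the value. From the
  -- top, the loop for `Rec` maintains the rounds left, the next index, the current value and the
  -- parameters; that for `Mu` the last value of `f` (initially 1), the next candidate and the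
  -- parameters.
  compile : ∀ {n} → Code n → Prog
  compile Z           = setZero
  compile S           = increment
  compile (P i)       = compileVar i
  compile (Comp f gs) = compileVec gs ⨾ compile f
  compile (Rec f g)   =
    recInit ⨾ compile f ⨾ recNext ⨾ while (recBody ⨾ compile g ⨾ recNext) ⨾ recEnd
  compile (Mu f)      = muInit ⨾ while (muBody ⨾ compile f) ⨾ muEnd

  compileVec : ∀ {m n} → Vec (Code n) m → Prog
  -- 0 codes the empty vector.
  compileVec []       = setZero
  compileVec (g ∷ gs) = dup ⨾ compileVec gs ⨾ swap ⨾ compile g ⨾ cons

⌜_⌝ᵛ : ∀ {n} → Vec ℕ n → ℕ
⌜ [] ⌝ᵛ    = 0
⌜ x ∷ v ⌝ᵛ = π x ⌜ v ⌝ᵛ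

opaque
  unfolding operationsF

  runs-setZero : ∀ a s → Runs setZero (π a s) (π 0 s)
  runs-setZero a s = Runs-op 0 lemma
    where
    lemma : exec 0 (π a s) ≡ π 0 s
    lemma rewrite snd-π a s = refl

  runs-increment : ∀ x w s → Runs increment (π (π x w) s) (π (suc x) s)
  runs-increment x w s = Runs-op 1 lemma
    where
    lemma : exec 1 (π (π x w) s) ≡ π (suc x) s
    lemma rewrite fst-π (π x w) s | snd-π (π x w) s | fst-π x w = refl

  runs-head : ∀ x w s → Runs head (π (π x w) s) (π x s)
  runs-head x w s = Runs-op 2 lemma
    where
    lemma : exec 2 (π (π x w) s) ≡ π x s
    lemma rewrite fst-π (π x w) s | snd-π (π x w) s | fst-π x w = refl

  runs-tail : ∀ x w s → Runs tail (π (π x w) s) (π w s)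
  runs-tail x w s = Runs-op 3 lemma
    where
    lemma : exec 3 (π (π x w) s) ≡ π w s
    lemma rewrite fst-π (π x w) s | snd-π (π x w) s | snd-π x w = refl

  runs-dup : ∀ a s → Runs dup (π a s) (π a (π a s))
  runs-dup a s = Runs-op 4 lemma
    where
    lemma : exec 4 (π a s) ≡ π a (π a s)
    lemma rewrite fst-π a s = refl

  runs-swap : ∀ a b s → Runs swap (π a (π b s)) (π b (π a s))
  runs-swap a b s = Runs-op 5 lemma
    where
    lemma : exec 5 (π a (π b s)) ≡ π b (π a s)
    lemma rewrite fst-π a (π b s) | snd-π a (π b s) | fst-π b s | snd-π b s = refl

  runs-cons : ∀ a b s → Runs cons (π a (π b s)) (π (π a b) s)
  runs-cons a b s = Runs-op 6 lemma
    where
    lemma : exec 6 (π a (π b s)) ≡ π (π a b) s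
    lemma rewrite fst-π a (π b s) | snd-π a (π b s) | fst-π b s | snd-π b s = refl

  runs-recInit : ∀ x w s → Runs recInit (π (π x w) s) (π w (π x (π 0 (π w s))))
  runs-recInit x w s = Runs-op 7 lemma
    where
    lemma : exec 7 (π (π x w) s) ≡ π w (π x (π 0 (π w s)))
    lemma rewrite fst-π (π x w) s | snd-π (π x w) s | fst-π x w | snd-π x w = refl

  runs-recBody : ∀ x y r w s → Runs recBody (π (suc x) (π y (π r (π w s))))
                                            (π (π y (π r w)) (π x (π (suc y) (π w s))))
  runs-recBody x y r w s = Runs-op 8 lemma
    where
    lemma : exec 8 (π (suc x) (π y (π r (π w s)))) ≡ π (π y (π r w)) (π x (π (suc y) (π w s)))
    lemma rewrite fst-π (suc x) (π y (π r (π w s))) | snd-π (suc x) (π y (π r (π w s)))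
      | fst-π y (π r (π w s)) | snd-π y (π r (π w s)) | fst-π r (π w s) | snd-π r (π w s)
      | fst-π w s = refl

  runs-recNext : ∀ r x y w s → Runs recNext (π r (π x (π y (π w s)))) (π x (π y (π r (π w s))))
  runs-recNext r x y w s = Runs-op 9 lemma
    where
    lemma : exec 9 (π r (π x (π y (π w s)))) ≡ π x (π y (π r (π w s)))
    lemma rewrite fst-π r (π x (π y (π w s))) | snd-π r (π x (π y (π w s)))
      | fst-π x (π y (π w s)) | snd-π x (π y (π w s)) | fst-π y (π w s) | snd-π y (π w s) = refl

  runs-recEnd : ∀ x y r w s → Runs recEnd (π x (π y (π r (π w s)))) (π r s)
  runs-recEnd x y r w s = Runs-op 10 lemma
    where
    lemma : exec 10 (π x (π y (π r (π w s)))) ≡ π r s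
    lemma rewrite snd-π x (π y (π r (π w s))) | snd-π y (π r (π w s))
      | fst-π r (π w s) | snd-π r (π w s) | snd-π w s = refl

  runs-muInit : ∀ w s → Runs muInit (π w s) (π 1 (π 0 (π w s)))
  runs-muInit w s = Runs-op 11 refl

  runs-muBody : ∀ b i w s → Runs muBody (π b (π i (π w s))) (π (π i w) (π (suc i) (π w s)))
  runs-muBody b i w s = Runs-op 12 lemma
    where
    lemma : exec 12 (π b (π i (π w s))) ≡ π (π i w) (π (suc i) (π w s))
    lemma rewrite snd-π b (π i (π w s)) | fst-π i (π w s) | snd-π i (π w s) | fst-π w s = refl

  -- The candidate has already been advanced when the loop ends, hence the result is one less.
  runs-muEnd : ∀ b i w s → Runs muEnd (π b (π (suc i) (π w s))) (π i s)
  runs-muEnd b i w s = Runs-op 13 lemma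
    where
    lemma : exec 13 (π b (π (suc i) (π w s))) ≡ π i s
    lemma rewrite snd-π b (π (suc i) (π w s)) | fst-π (suc i) (π w s) | snd-π (suc i) (π w s)
      | snd-π w s = refl

compileVar-correct : ∀ {n} (i : Fin n) v s → Runs (compileVar i) (π ⌜ v ⌝ᵛ s) (π (lookup v i) s)
compileVar-correct Fin.zero    (x ∷ v) s = runs-head x ⌜ v ⌝ᵛ s
compileVar-correct (Fin.suc i) (x ∷ v) s =
  Runs-⨾ (runs-tail x ⌜ v ⌝ᵛ s) (compileVar-correct i v s)

mutual
  compile-correct : ∀ {n} k (c : Code n) v {y} s → eval k c v ≡ just y →
                    Runs (compile c) (π ⌜ v ⌝ᵛ s) (π y s)
  compile-correct (suc k) Z v s refl = runs-setZero ⌜ v ⌝ᵛ s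
  compile-correct (suc k) S (x ∷ []) s refl = runs-increment x 0 s
  compile-correct (suc k) (P i) v s refl = compileVar-correct i v s
  compile-correct (suc k) (Comp f gs) v s eq with >>=-just (evalVec k gs v) eq
  ... | w , e₁ , e₂ =
    Runs-⨾ (compileVec-correct k gs v s e₁) (compile-correct k f w s e₂)
  compile-correct (suc k) (Rec f g) (x ∷ v) {y} s eq with Rec-loop-correct k f g v s x eq
  ... | r , e , loop =
    Runs-⨾ (runs-recInit x ⌜ v ⌝ᵛ s)
    (Runs-⨾ (compile-correct k f v _ e)
    (Runs-⨾ (runs-recNext r x 0 ⌜ v ⌝ᵛ s)
    (Runs-⨾ (subst (λ z → Runs (while (recBody ⨾ compile g ⨾ recNext))
                    (π z (π 0 (π r (π ⌜ v ⌝ᵛ s)))) (π 0 (π x (π y (π ⌜ v ⌝ᵛ s)))))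
              (+-identityʳ x) (loop 0 (Runs-while-zero _ (fst-π 0 _))))
            (runs-recEnd 0 x y ⌜ v ⌝ᵛ s))))
  compile-correct (suc k) (Mu f) v {y} s eq =
    Runs-⨾ (runs-muInit ⌜ v ⌝ᵛ s)
    (Runs-⨾ (Mu-loop-correct k f v s k 0 0 eq) (runs-muEnd 0 y ⌜ v ⌝ᵛ s))

  compileVec-correct : ∀ {m n} k (gs : Vec (Code n) m) v {w} s → evalVec k gs v ≡ just w →
                       Runs (compileVec gs) (π ⌜ v ⌝ᵛ s) (π ⌜ w ⌝ᵛ s)
  compileVec-correct k [] v s refl = runs-setZero ⌜ v ⌝ᵛ s
  compileVec-correct k (g ∷ gs) v s eq with >>=-just (eval k g v) eq
  ... | a , e₁ , eq′ with >>=-just (evalVec k gs v) eq′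
  ... | as , e₂ , refl =
    Runs-⨾ (runs-dup ⌜ v ⌝ᵛ s)
    (Runs-⨾ (compileVec-correct k gs v _ e₂)
    (Runs-⨾ (runs-swap ⌜ as ⌝ᵛ ⌜ v ⌝ᵛ s)
    (Runs-⨾ (compile-correct k g v _ e₁) (runs-cons a ⌜ as ⌝ᵛ s))))

  -- `while` unfolds from its first round, the recursion from its last. The induction on `x`
  -- therefore takes any run of the loop with `z` rounds left and puts the first `x` rounds in front
  -- of it.
  Rec-loop-correct : ∀ {n} k (f : Code n) g v s x {y} → eval (suc k) (Rec f g) (x ∷ v) ≡ just y →
    ∃ λ r → eval k f v ≡ just r × (∀ z {s′} →
      Runs (while (recBody ⨾ compile g ⨾ recNext)) (π z (π x (π y (π ⌜ v ⌝ᵛ s)))) s′ →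
      Runs (while (recBody ⨾ compile g ⨾ recNext)) (π (x + z) (π 0 (π r (π ⌜ v ⌝ᵛ s)))) s′)
  Rec-loop-correct k f g v s zero {y} eq = y , eq , λ z h → h
  Rec-loop-correct k f g v s (suc x) {y} eq
    with >>=-just (eval (suc k) (Rec f g) (x ∷ v)) (trans (sym (eval-Rec-suc k f g x v)) eq)
  ... | q , e₁ , e₂ with Rec-loop-correct k f g v s x e₁
  ... | r , e , loop = r , e , λ z {s′} h →
    subst (λ u → Runs (while (recBody ⨾ compile g ⨾ recNext)) (π u (π 0 (π r (π ⌜ v ⌝ᵛ s)))) s′)
      (+-suc x z)
      (loop (suc z) (Runs-while-suc (fst-π (suc z) _)
        (Runs-⨾ (runs-recBody z x q ⌜ v ⌝ᵛ s)
        (Runs-⨾ (compile-correct k g (x ∷ q ∷ v) _ e₂) (runs-recNext y z (suc x) ⌜ v ⌝ᵛ s)))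
        h))

  -- The flag `suc b` stands for the initial 1 or for the previous nonzero value of `f`, so `b` must
  -- be arbitrary for the induction.
  Mu-loop-correct : ∀ {n} k (f : Code (suc n)) v {y} s j i b → searchMu k f v j i ≡ just y →
    Runs (while (muBody ⨾ compile f)) (π (suc b) (π i (π ⌜ v ⌝ᵛ s))) (π 0 (π (suc y) (π ⌜ v ⌝ᵛ s)))
  Mu-loop-correct k f v s (suc j) i b eq with eval k f (i ∷ v) in e
  Mu-loop-correct k f v s (suc j) i b refl | just zero =
    Runs-while-suc (fst-π (suc b) _)
      (Runs-⨾ (runs-muBody (suc b) i ⌜ v ⌝ᵛ s) (compile-correct k f (i ∷ v) _ e))
      (Runs-while-zero _ (fst-π 0 _))
  Mu-loop-correct k f v s (suc j) i b eq | just (suc m) =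
    Runs-while-suc (fst-π (suc b) _)
      (Runs-⨾ (runs-muBody (suc b) i ⌜ v ⌝ᵛ s) (compile-correct k f (i ∷ v) _ e))
      (Mu-loop-correct k f v s j (suc i) m eq)

-- Machine e has halted as soon as its stack of remaining programs, coded by `todo`, is 0.
start : ℕ → ℕ → ℕ
start e x = π (suc (π e 0)) (π (π x 0) 0)

opaque
  todo : ℕ → ℕ → ℕ → ℕ
  todo e x t = fst (run t (start e x))

  output : ℕ → ℕ → ℕ → ℕ
  output e x t = snd (run t (start e x))

  todo-def : ∀ e x t → fst (run t (start e x)) ≡ todo e x t
  todo-def e x t = refl

  output-def : ∀ e x t → snd (run t (start e x)) ≡ output e x t
  output-def e x t = refl

  -- One program is pending at time 0. Halting is therefore first reached at some `suc t` with the
  -- machine still busy at `t`.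
  todo-zero : ∀ e x → todo e x 0 ≢ 0
  todo-zero e x eq with trans (sym eq) (trans (cong fst (run-zero _)) (fst-π (suc (π e 0)) _))
  ... | ()

  todo-stable : ∀ {e x s t} → s ≤ t → todo e x s ≡ 0 → todo e x t ≡ 0
  todo-stable {e} {x} s≤t h = trans (cong fst (run-halted-≤ (start e x) s≤t h)) h

  output-stable : ∀ {e x s t} → s ≤ t → todo e x s ≡ 0 → output e x t ≡ output e x s
  output-stable {e} {x} s≤t h = cong snd (run-halted-≤ (start e x) s≤t h)

  compile-halts : ∀ (c : Code 1) {x y} → c ⟨ x ⟩≃ y →
    ∃ λ t → todo ⌜ compile c ⌝ x t ≡ 0 × output ⌜ compile c ⌝ x t ≡ π y 0
  compile-halts c {x} {y} (k , eq) with Runs⇒run (compile-correct k c (x ∷ []) 0 eq)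
  ... | t , r = t , trans (cong fst r) (fst-π 0 _) , trans (cong snd r) (snd-π 0 _)

private
  startF : ∀ {n} → Fn n → Fn n → Fn n
  startF E X = πF (sucF (πF E (const 0))) (πF (πF X (const 0)) (const 0))

todoF : ∀ {n} → Fn n → Fn n → Fn n → Fn n
todoF E X T = respec₃ (fstF (runF (var (# 2)) (startF (var (# 0)) (var (# 1))))) todo todo-def
  $ (E ∷ X ∷ T ∷ [])

outputF : ∀ {n} → Fn n → Fn n → Fn n → Fn n
outputF E X T = respec₃ (sndF (runF (var (# 2)) (startF (var (# 0)) (var (# 1))))) output output-def
  $ (E ∷ X ∷ T ∷ [])

-- The order

-- The `suc` keeps the second component positive; since larger ones come first, the base element
-- `π j 0` ends its block.
inserted : ℕ → ℕ → ℕ → ℕ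
inserted j e t = π j (suc (π e (π t (output e (pred j) (suc t)))))

-- Being busy at `t` and halted at `suc t` fixes `t`. So a machine contributes at most one element
-- to a block, and membership is decidable without deciding which machines halt.
data Element : ℕ → Set where
  base : ∀ j → Element (π j 0)
  new  : ∀ j e t → e < j → todo e (pred j) t ≢ 0 → todo e (pred j) (suc t) ≡ 0 →
         Element (inserted j e t)

π-Element : ∀ {x} → Element x → π (fst x) (snd x) ≡ x
π-Element (base j) = cong₂ π (fst-π j 0) (snd-π j 0)
π-Element (new j e t _ _ _) = cong₂ π (fst-π j _) (snd-π j _)

infix 4 _◁_
_◁_ : ℕ → ℕ → Set
x ◁ y = fst x < fst y ⊎ (fst x ≡ fst y × snd y < snd x)

◁-irrefl : ∀ {x} → ¬ x ◁ x
◁-irrefl (inj₁ p) = <-irrefl refl p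
◁-irrefl (inj₂ (_ , p)) = <-irrefl refl p

◁-trans : ∀ {x y z} → x ◁ y → y ◁ z → x ◁ z
◁-trans (inj₁ p) (inj₁ q) = inj₁ (<-trans p q)
◁-trans (inj₁ p) (inj₂ (e , _)) = inj₁ (subst (_ <_) e p)
◁-trans (inj₂ (e , _)) (inj₁ q) = inj₁ (subst (_< _) (sym e) q)
◁-trans (inj₂ (e , p)) (inj₂ (e′ , q)) = inj₂ (trans e e′ , <-trans q p)

◁-total : ∀ {x y} → Element x → Element y → x ◁ y ⊎ x ≡ y ⊎ y ◁ x
◁-total {x} {y} x∈ y∈ with <-cmp (fst x) (fst y)
... | tri< p _ _ = inj₁ (inj₁ p)
... | tri> _ _ p = inj₂ (inj₂ (inj₁ p))
... | tri≈ _ e _ with <-cmp (snd x) (snd y)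
... | tri< p _ _  = inj₂ (inj₂ (inj₂ (sym e , p)))
... | tri≈ _ e′ _ = inj₂ (inj₁ (trans (sym (π-Element x∈)) (trans (cong₂ π e e′) (π-Element y∈))))
... | tri> _ _ p  = inj₁ (inj₂ (e , p))

-- Computability of the order

distance : ℕ → ℕ → ℕ
distance x y = (x ∸ y) + (y ∸ x)

distance≡0 : ∀ {x y} → distance x y ≡ 0 → x ≡ y
distance≡0 {x} {y} h = ≤-antisym (m∸n≡0⇒m≤n (m+n≡0⇒m≡0 (x ∸ y) h)) (m∸n≡0⇒m≤n (m+n≡0⇒n≡0 (x ∸ y) h))

distance-refl : ∀ x → distance x x ≡ 0
distance-refl x = cong₂ _+_ (n∸n≡0 x) (n∸n≡0 x)

distanceF : ∀ {n} → Fn n → Fn n → Fn n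
distanceF F G = (F ⊖ G) ⊕ (G ⊖ F)

1∸n≡1⇒n≡0 : ∀ n → 1 ∸ n ≡ 1 → n ≡ 0
1∸n≡1⇒n≡0 zero _ = refl
1∸n≡1⇒n≡0 (suc n) h with trans (sym (0∸n≡0 n)) h
... | ()

1∸n≡0⇒n≢0 : ∀ n → 1 ∸ n ≡ 0 → n ≢ 0
1∸n≡0⇒n≢0 _ () refl

n≢0⇒1∸n≡0 : ∀ n → n ≢ 0 → 1 ∸ n ≡ 0
n≢0⇒1∸n≡0 zero h = ⊥-elim (h refl)
n≢0⇒1∸n≡0 (suc n) _ = 0∸n≡0 n

insertedF : ∀ {n} → Fn n → Fn n → Fn n → Fn n
insertedF J E T = πF J (sucF (πF E (πF T (outputF E (predF J) (sucF T)))))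

-- In the following tests 0 means true, hence * is disjunction and + is conjunction.
newTest : ℕ → ℕ → ℕ → ℕ → ℕ
newTest x j e t = distance x (inserted j e t) + (suc e ∸ j)
  + (1 ∸ todo e (pred j) t) + todo e (pred j) (suc t)

-- `j`, `e` and `t` are decoded from `x`; comparison with the re-encoded element rejects every `x`
-- that codes no such data.
elementTest : ℕ → ℕ
elementTest x = distance x (π (fst x) 0)
  * newTest x (fst x) (fst (pred (snd x))) (fst (snd (pred (snd x))))

elementTest-sound : ∀ x → elementTest x ≡ 0 → Element x
elementTest-sound x h with m*n≡0⇒m≡0∨n≡0 (distance x (π (fst x) 0)) h
... | inj₁ x≡ = subst Element (sym (distance≡0 x≡)) (base (fst x))
... | inj₂ h₁ = subst Element (sym (distance≡0 (m+n≡0⇒m≡0 d h₃)))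
  (new j e t (m∸n≡0⇒m≤n (m+n≡0⇒n≡0 d h₃))
    (1∸n≡0⇒n≢0 (todo e (pred j) t) (m+n≡0⇒n≡0 (d + (suc e ∸ j)) h₂))
    (m+n≡0⇒n≡0 (d + (suc e ∸ j) + (1 ∸ todo e (pred j) t)) h₁))
  where
  j = fst x
  e = fst (pred (snd x))
  t = fst (snd (pred (snd x)))
  d = distance x (inserted j e t)
  h₂ : d + (suc e ∸ j) + (1 ∸ todo e (pred j) t) ≡ 0
  h₂ = m+n≡0⇒m≡0 _ h₁
  h₃ : d + (suc e ∸ j) ≡ 0
  h₃ = m+n≡0⇒m≡0 _ h₂

elementTest-complete : ∀ {x} → Element x → elementTest x ≡ 0
elementTest-complete (base j) rewrite fst-π j 0 | distance-refl (π j 0) = refl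
elementTest-complete (new j e t e<j h h′)
  rewrite snd-π j (suc (π e (π t (output e (pred j) (suc t)))))
        | fst-π j (suc (π e (π t (output e (pred j) (suc t)))))
        | snd-π e (π t (output e (pred j) (suc t)))
        | fst-π e (π t (output e (pred j) (suc t)))
        | fst-π t (output e (pred j) (suc t))
        | distance-refl (inserted j e t) | m≤n⇒m∸n≡0 e<j | n≢0⇒1∸n≡0 _ h | h′
  = *-zeroʳ (distance (inserted j e t) (π j 0))

opaque
  elementF : Fn 1
  elementF = const 1 ⊖ distanceF x (πF j (const 0)) ⊗
    (distanceF x (insertedF j e t) ⊕ (sucF e ⊖ j) ⊕ (const 1 ⊖ todoF e (predF j) t) ⊕ todoF e (predF j) (sucF t))
    where
    x j e t : Fn 1
    x = var (# 0)
    j = fstF x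
    e = fstF (predF (sndF x))
    t = fstF (sndF (predF (sndF x)))

  elementF-fn : ∀ x → fn elementF (x ∷ []) ≡ 1 ∸ elementTest x
  elementF-fn x = refl

lessTest : ℕ → ℕ → ℕ
lessTest x y = (suc (fst x) ∸ fst y) * (distance (fst x) (fst y) + (suc (snd y) ∸ snd x))

lessTest-sound : ∀ x y → lessTest x y ≡ 0 → x ◁ y
lessTest-sound x y h with m*n≡0⇒m≡0∨n≡0 (suc (fst x) ∸ fst y) h
... | inj₁ h₁ = inj₁ (m∸n≡0⇒m≤n h₁)
... | inj₂ h₁ = inj₂ (distance≡0 (m+n≡0⇒m≡0 _ h₁) , m∸n≡0⇒m≤n (m+n≡0⇒n≡0 (distance (fst x) (fst y)) h₁))

lessTest-complete : ∀ {x y} → x ◁ y → lessTest x y ≡ 0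
lessTest-complete (inj₁ p) rewrite m≤n⇒m∸n≡0 p = refl
lessTest-complete {x} {y} (inj₂ (e , p)) rewrite e | distance-refl (fst y) | m≤n⇒m∸n≡0 p =
  *-zeroʳ (suc (fst y) ∸ fst y)

opaque
  lessF : Fn 2
  lessF = const 1 ⊖ (sucF (fstF x) ⊖ fstF y) ⊗ (distanceF (fstF x) (fstF y) ⊕ (sucF (sndF y) ⊖ sndF x))
    where
    x y : Fn 2
    x = var (# 0)
    y = var (# 1)

  lessF-fn : ∀ x y → fn lessF (x ∷ y ∷ []) ≡ 1 ∸ lessTest x y
  lessF-fn x y = refl

𝓛 : CompOrder
𝓛 = record
  { domCode  = code elementF
  ; ordCode  = code lessF
  ; domTotal = λ x → fn elementF (x ∷ []) , halts elementF (x ∷ [])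
  ; ordTotal = λ x y → fn lessF (x ∷ y ∷ []) , halts lessF (x ∷ y ∷ [])
  }

open CompOrder 𝓛 using (InL; _≺_)

InL⇒Element : ∀ {x} → InL x → Element x
InL⇒Element {x} h = elementTest-sound x (1∸n≡1⇒n≡0 (elementTest x) (trans (sym (elementF-fn x)) (Halts⇒fn elementF h)))

Element⇒InL : ∀ {x} → Element x → InL x
Element⇒InL {x} x∈ = fn⇒Halts elementF (trans (elementF-fn x) (cong (1 ∸_) (elementTest-complete x∈)))

≺⇒◁ : ∀ {x y} → x ≺ y → x ◁ y
≺⇒◁ {x} {y} h = lessTest-sound x y (1∸n≡1⇒n≡0 (lessTest x y) (trans (sym (lessF-fn x y)) (Halts⇒fn lessF h)))

◁⇒≺ : ∀ {x y} → x ◁ y → x ≺ y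
◁⇒≺ {x} {y} h = fn⇒Halts lessF (trans (lessF-fn x y) (cong (1 ∸_) (lessTest-complete h)))

Element? : ∀ x → Dec (Element x)
Element? x with elementTest x ≟ 0
... | yes h = yes (elementTest-sound x h)
... | no h = no λ x∈ → h (elementTest-complete x∈)

_◁?_ : ∀ x y → Dec (x ◁ y)
x ◁? y with lessTest x y ≟ 0
... | yes h = yes (lessTest-sound x y h)
... | no h = no λ p → h (lessTest-complete p)
-- Orders of type ω

-- The enumeration starts at the least element and passes to immediate successors. These can be
-- found because the order is decidable and unbounded and the predecessors of `x` are numbers below
-- `bound x`.
module Enumerate
  (In : ℕ → Set) (_≺_ : ℕ → ℕ → Set)
  (In? : ∀ x → Dec (In x)) (_≺?_ : ∀ x y → Dec (x ≺ y))
  (≺-irrefl : ∀ {x} → ¬ x ≺ x) (≺-trans : ∀ {x y z} → x ≺ y → y ≺ z → x ≺ z)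
  (≺-total : ∀ {x y} → In x → In y → x ≺ y ⊎ x ≡ y ⊎ y ≺ x)
  (bound : ℕ → ℕ) (below-bound : ∀ {x y} → In y → y ≺ x → y < bound x)
  (inhabited : ∃ In) (unbounded : ∀ x → ∃ λ y → In y × x ≺ y)
  where

  Minimum : (ℕ → Set) → ℕ → Set
  Minimum Q m = Q m × (∀ y → Q y → y ≡ m ⊎ m ≺ y)

  minimum : (Q : ℕ → Set) → (∀ x → Dec (Q x)) → (∀ {x} → Q x → In x) → ∃ Q → ∃ (Minimum Q)
  -- Only `x` and its predecessors compete for the minimum, and all of them are below
  -- `suc x ⊔ bound x`.
  minimum Q Q? Q⊆In (x , qx) with below (suc x ⊔ bound x)
    where
    below : ∀ n → (∃ λ m → Q m × (∀ y → y < n → Q y → y ≡ m ⊎ m ≺ y)) ⊎ (∀ y → y < n → ¬ Q y)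
    below zero = inj₂ λ _ ()
    below (suc n) with below n | Q? n
    ... | inj₂ none | no ¬qn = inj₂ (<-suc-elim none ¬qn)
    ... | inj₂ none | yes qn =
      inj₁ (n , qn , <-suc-elim (λ y y<n qy → ⊥-elim (none y y<n qy)) (λ _ → inj₁ refl))
    ... | inj₁ (m , qm , least) | no ¬qn =
      inj₁ (m , qm , <-suc-elim least (λ qn → ⊥-elim (¬qn qn)))
    ... | inj₁ (m , qm , least) | yes qn with ≺-total (Q⊆In qm) (Q⊆In qn)
    ... | inj₁ m≺n         = inj₁ (m , qm , <-suc-elim least (λ _ → inj₂ m≺n))
    ... | inj₂ (inj₁ refl) = inj₁ (m , qm , <-suc-elim least (λ _ → inj₁ refl))
    ... | inj₂ (inj₂ n≺m)  = inj₁ (n , qn , <-suc-elim (λ y y<n qy → inj₂ (n≺ (least y y<n qy))) (λ _ → inj₁ refl))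
      where
      n≺ : ∀ {y} → y ≡ m ⊎ m ≺ y → n ≺ y
      n≺ (inj₁ refl) = n≺m
      n≺ (inj₂ m≺y)  = ≺-trans n≺m m≺y
  ... | inj₂ none = ⊥-elim (none x (m≤m⊔n (suc x) (bound x)) qx)
  ... | inj₁ (m , qm , least) = m , qm , least′
    where
    m≼x : x ≡ m ⊎ m ≺ x
    m≼x = least x (m≤m⊔n (suc x) (bound x)) qx

    m≺above-x : ∀ {y} → x ≺ y → m ≺ y
    m≺above-x x≺y with m≼x
    ... | inj₁ refl = x≺y
    ... | inj₂ m≺x  = ≺-trans m≺x x≺y

    least′ : ∀ y → Q y → y ≡ m ⊎ m ≺ y
    least′ y qy with ≺-total (Q⊆In qx) (Q⊆In qy)
    ... | inj₁ x≺y         = inj₂ (m≺above-x x≺y)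
    ... | inj₂ (inj₁ refl) = m≼x
    ... | inj₂ (inj₂ y≺x)  = least y (≤-trans (below-bound (Q⊆In qy) y≺x) (m≤n⊔m (suc x) _)) qy

  successor : ∀ x → ∃ (Minimum λ y → In y × x ≺ y)
  successor x = minimum _ (λ y → In? y ×-dec (x ≺? y)) proj₁ (unbounded x)

  enum : ℕ → ℕ
  enum zero    = proj₁ (minimum In In? (λ x∈ → x∈) inhabited)
  enum (suc n) = proj₁ (successor (enum n))

  enum-In : ∀ n → In (enum n)
  enum-In zero    = proj₁ (proj₂ (minimum In In? (λ x∈ → x∈) inhabited))
  enum-In (suc n) = proj₁ (proj₁ (proj₂ (successor (enum n))))

  enum-mono : ∀ {m n} → m < n → enum m ≺ enum n
  enum-mono {m} {suc n} (s≤s m≤n) with m≤n⇒m<n∨m≡n m≤n | proj₂ (proj₁ (proj₂ (successor (enum n))))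
  ... | inj₁ m<n  | step = ≺-trans (enum-mono m<n) step
  ... | inj₂ refl | step = step

  enum-cancel : ∀ {m n} → enum m ≺ enum n → m < n
  enum-cancel {m} {n} p with <-cmp m n
  ... | tri< m<n _ _  = m<n
  ... | tri≈ _ refl _ = ⊥-elim (≺-irrefl p)
  ... | tri> _ _ n<m  = ⊥-elim (≺-irrefl (≺-trans p (enum-mono n<m)))

  -- By minimality of each step, no element is skipped between `enum n` and `enum (suc n)`.
  enum-exhausts : ∀ n {x} → In x → (∃ λ k → enum k ≡ x) ⊎ enum n ≺ x
  enum-exhausts zero {x} x∈ with proj₂ (proj₂ (minimum In In? (λ x∈ → x∈) inhabited)) x x∈
  ... | inj₁ x≡ = inj₁ (0 , sym x≡)
  ... | inj₂ p  = inj₂ p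
  enum-exhausts (suc n) {x} x∈ with enum-exhausts n x∈
  ... | inj₁ found = inj₁ found
  ... | inj₂ p with proj₂ (proj₂ (successor (enum n))) x (x∈ , p)
  ... | inj₁ x≡ = inj₁ (suc n , sym x≡)
  ... | inj₂ q  = inj₂ q

  -- Otherwise enum 0, …, enum (bound x) would be distinct numbers below bound x.
  enum-surjective : ∀ {x} → In x → ∃ λ k → enum k ≡ x
  enum-surjective {x} x∈ with enum-exhausts (bound x) x∈
  ... | inj₁ found = found
  ... | inj₂ p = ⊥-elim (absurd (Fin.pigeonhole (n<1+n (bound x)) (λ i → Fin.fromℕ< (small i))))
    where
    small : (i : Fin (suc (bound x))) → enum (toℕ i) < bound x
    small i with m≤n⇒m<n∨m≡n (≤-pred (Fin.toℕ<n i))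
    ... | inj₁ i<b = below-bound (enum-In (toℕ i)) (≺-trans (enum-mono i<b) p)
    ... | inj₂ i≡b = below-bound (enum-In (toℕ i)) (subst (λ k → enum k ≺ x) (sym i≡b) p)

    absurd : ¬ (∃ λ i → ∃ λ j → i Fin.< j × Fin.fromℕ< (small i) ≡ Fin.fromℕ< (small j))
    absurd (i , j , i<j , eq) = ≺-irrefl (subst (_≺ enum (toℕ j)) same (enum-mono i<j))
      where
      same : enum (toℕ i) ≡ enum (toℕ j)
      same = trans (sym (Fin.toℕ-fromℕ< (small i))) (trans (cong toℕ eq) (Fin.toℕ-fromℕ< (small j)))

-- Bounding predecessors by cohesiveness

module _ {C : Subset} (C-cohesive : Cohesive C) where

  halting-decidable : ∀ e n → (∃ λ t → todo e n (suc t) ≡ 0) ⊎ (∀ t → todo e n (suc t) ≢ 0)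
  halting-decidable e n = decide (proj₂ C-cohesive W)
    where
    opaque
      haltedF : Fn 2
      haltedF = todoF (const e) (const n) (sucF (var (# 1)))

      halted-fn : ∀ i x → fn haltedF (i ∷ x ∷ []) ≡ todo e n (suc x)
      halted-fn i x = cong₂ (λ a b → todo a b (suc x)) (fn-const e (i ∷ x ∷ [])) (fn-const n (i ∷ x ∷ []))

    W : Code 1
    -- `haltedF` is constant in the search variable, so the search stops at 0 or diverges: the
    -- domain of `W` consists of the `x` such that `e` has halted on `n` at time `suc x`.
    W = Mu (code haltedF)

    todo⇒Dom : ∀ {x} → todo e n (suc x) ≡ 0 → Dom W x
    todo⇒Dom {x} h = Mu-halts (λ i → fn haltedF (i ∷ x ∷ [])) (λ i → halts haltedF (i ∷ x ∷ [])) 0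
      (trans (halted-fn 0 x) h)

    Dom⇒todo : ∀ {x} → Dom W x → todo e n (suc x) ≡ 0
    Dom⇒todo {x} (i , h) = trans (sym (halted-fn i x)) (Halts⇒fn haltedF (proj₁ (Mu-halts⁻ h)))

    decide : Finite (λ x → C x × ¬ Dom W x) ⊎ Finite (λ x → C x × Dom W x) →
             (∃ λ t → todo e n (suc t) ≡ 0) ⊎ (∀ t → todo e n (suc t) ≢ 0)
    decide (inj₁ (N , finite)) with proj₁ C-cohesive N
    ... | x , N≤x , x∈C with todo e n (suc x) ≟ 0
    ... | yes h = inj₁ (x , h)
    ... | no h  = ⊥-elim (finite x N≤x (x∈C , λ d → h (Dom⇒todo d)))
    decide (inj₂ (N , finite)) = inj₂ never
      where
      never : ∀ t → todo e n (suc t) ≢ 0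
      never t h with proj₁ C-cohesive (N ⊔ t)
      -- Being beyond `t`, this `x` is in the domain of `W` by stability; being beyond `N`, it must
      -- not be.
      ... | x , N⊔t≤x , x∈C = finite x (≤-trans (m≤m⊔n N t) N⊔t≤x)
        (x∈C , todo⇒Dom (todo-stable (s≤s (≤-trans (m≤n⊔m N t) N⊔t≤x)) h))

  -- Whichever halting time `suc s` is found, the first one is not later, and the output no longer
  -- changes after it; monotonicity of `π` gives the bound.
  halting-bound : ∀ e n → ∃ λ b → ∀ t → todo e n t ≢ 0 → todo e n (suc t) ≡ 0 →
                  π t (output e n (suc t)) ≤ b
  halting-bound e n with halting-decidable e n
  -- No `t` meets the hypotheses, so 0 is an arbitrary choice.
  ... | inj₂ never = 0 , λ t _ h → ⊥-elim (never t h)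
  ... | inj₁ (s , s-halted) = π s (output e n (suc s)) , bound
    where
    bound : ∀ t → todo e n t ≢ 0 → todo e n (suc t) ≡ 0 → π t (output e n (suc t)) ≤ π s (output e n (suc s))
    bound t t-busy t-halted with t ≤? s
    ... | yes t≤s = π-mono t≤s (≤-reflexive (sym (output-stable (s≤s t≤s) t-halted)))
    ... | no t≰s  = ⊥-elim (t-busy (todo-stable (≰⇒> t≰s) s-halted))

  -- The maxima run over all machines and inputs below `j`. This covers all blocks up to `j` at
  -- once, as the predecessors of an element of block `j` require.
  block-bound : ℕ → ℕ
  block-bound j = bounded-max (λ e → bounded-max (λ n → proj₁ (halting-bound e n)) j) j

  predecessor-bound : ℕ → ℕ
  predecessor-bound x = suc (π (fst x) (suc (π (fst x) (block-bound (fst x)))))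

  ◁⇒fst-≤ : ∀ {x y} → x ◁ y → fst x ≤ fst y
  ◁⇒fst-≤ (inj₁ p)       = <⇒≤ p
  ◁⇒fst-≤ (inj₂ (e , _)) = ≤-reflexive e

  Element-bound : ∀ {y J} → Element y → fst y ≤ J → y ≤ π J (suc (π J (block-bound J)))
  Element-bound (base j) h = π-mono (subst (_≤ _) (fst-π j 0) h) z≤n
  Element-bound {J = J} (new j e t e<j t-busy t-halted) h =
    π-mono j≤J (s≤s (π-mono (≤-trans (<⇒≤ e<j) j≤J)
      (≤-trans (proj₂ (halting-bound e (pred j)) t t-busy t-halted)
      (≤-trans (≤-bounded-max (λ n → proj₁ (halting-bound e n)) (pred< e<j))
               (≤-bounded-max (λ e → bounded-max (λ n → proj₁ (halting-bound e n)) J)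
                 (<-≤-trans e<j j≤J))))))
    where
    j≤J : j ≤ J
    j≤J = subst (_≤ J) (fst-π j _) h
    pred< : ∀ {e} → e < j → pred j < J
    pred< (s≤s _) = j≤J

  below-predecessor-bound : ∀ {x y} → Element y → y ◁ x → y < predecessor-bound x
  below-predecessor-bound {x} y∈ y◁x = s≤s (Element-bound y∈ (◁⇒fst-≤ {y = x} y◁x))

  open Enumerate Element _◁_ Element? _◁?_ (λ {x} → ◁-irrefl {x}) (λ {x y z} → ◁-trans {x} {y} {z}) ◁-total
    predecessor-bound below-predecessor-bound (π 0 0 , base 0)
    (λ x → π (suc (fst x)) 0 , base _ , inj₁ (≤-reflexive (sym (fst-π (suc (fst x)) 0))))

  𝓛-OrderTypeω : OrderTypeω 𝓛
  𝓛-OrderTypeω = enum , (λ n → Element⇒InL (enum-In n))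
    , (λ m n → (λ m<n → ◁⇒≺ {enum m} {enum n} (enum-mono m<n)) , (λ h → enum-cancel (≺⇒◁ h)))
    , (λ x x∈ → enum-surjective (InL⇒Element x∈))

-- The cohesive power

opaque
  baseF : Fn 1
  baseF = πF (var (# 0)) (const 0)

  baseF-fn : ∀ x → fn baseF (x ∷ []) ≡ π x 0
  baseF-fn x = refl

module Between (e : ℕ) where

  value : ℕ → ℕ → ℕ
  value n t = π (suc n) (ifz (e ∸ n) (suc (π e (π t (output e n (suc t))))) 0)

  opaque
    -- The search is for `t` while the test concerns time `suc t`; its least solution is thus the
    -- `t` of the constructor `new`.
    haltedF : Fn 2
    haltedF = todoF (const e) (var (# 1)) (sucF (var (# 0)))

    haltedF-fn : ∀ t n → fn haltedF (t ∷ n ∷ []) ≡ todo e n (suc t)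
    haltedF-fn t n rewrite fn-const e (t ∷ n ∷ []) = refl

    -- The case distinction makes every value an element of 𝓛, as membership
    -- in the carrier of the cohesive power requires.
    valueF : Fn 2
    valueF = πF (sucF (var (# 1))) (ifzF (const e ⊖ var (# 1))
      (sucF (πF (const e) (πF (var (# 0)) (outputF (const e) (var (# 1)) (sucF (var (# 0))))))) (const 0))

    valueF-fn : ∀ t n → fn valueF (t ∷ n ∷ []) ≡ value n t
    valueF-fn t n rewrite fn-const e (t ∷ n ∷ []) = refl

  between : Code 1
  between = Comp (code valueF) (Mu (code haltedF) ∷ P (# 0) ∷ [])

  search-halts : ∀ {n t} → todo e n (suc t) ≡ 0 → ∃ λ s → Halts (Mu (code haltedF)) (n ∷ []) s
  search-halts {n} {t} h = Mu-halts (λ t → fn haltedF (t ∷ n ∷ [])) (λ t → halts haltedF (t ∷ n ∷ [])) t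
    (trans (haltedF-fn t n) h)

  -- If `t` is positive, the trial `t - 1` tested time `t` and failed; at time 0 every machine is
  -- busy.
  search-halts⁻ : ∀ {n t} → Halts (Mu (code haltedF)) (n ∷ []) t →
                  todo e n t ≢ 0 × todo e n (suc t) ≡ 0
  search-halts⁻ {n} {t} h with Mu-halts⁻ h
  ... | h₀ , below = busy t below , trans (sym (haltedF-fn t n)) (Halts⇒fn haltedF h₀)
    where
    busy : ∀ t → (∀ i → i < t → ∃ λ m → Halts (code haltedF) (i ∷ n ∷ []) (suc m)) → todo e n t ≢ 0
    busy zero below = todo-zero e n
    busy (suc t) below h with below t (n<1+n t)
    ... | m , p with trans (sym (Halts⇒fn haltedF p)) (trans (haltedF-fn t n) h)
    ... | ()

  between-halts : ∀ {n t} → Halts (Mu (code haltedF)) (n ∷ []) t → between ⟨ n ⟩≃ value n t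
  between-halts {n} {t} h =
    Comp-halts (HaltsVec-∷ h (HaltsVec-∷ (1 , refl) HaltsVec-[])) (fn⇒Halts valueF (valueF-fn t n))

  between-halts⁻ : ∀ {n y} → between ⟨ n ⟩≃ y → ∃ λ t → Halts (Mu (code haltedF)) (n ∷ []) t × value n t ≡ y
  between-halts⁻ h with Comp-halts⁻ h
  ... | _ , hs , _ with HaltsVec-∷⁻ hs
  ... | t , ht = t , ht , Halts-deterministic (between-halts ht) h

  value-Element : ∀ n t → todo e n t ≢ 0 → todo e n (suc t) ≡ 0 → Element (value n t)
  value-Element n t busy halted with e ∸ n in eq
  ... | zero  = new (suc n) e t (s≤s (m∸n≡0⇒m≤n eq)) busy halted
  ... | suc _ = base (suc n)

  between-InL : ∀ n y → between ⟨ n ⟩≃ y → InL y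
  between-InL n y h with between-halts⁻ h
  ... | t , ht , refl = Element⇒InL (value-Element n t (proj₁ halted) (proj₂ halted))
    where
    halted : todo e n t ≢ 0 × todo e n (suc t) ≡ 0
    halted = search-halts⁻ ht

  base◁value : ∀ n t → π n 0 ◁ value n t
  base◁value n t = inj₁ (≤-reflexive (trans (cong suc (fst-π n 0)) (sym (fst-π (suc n) _))))

  value◁ : ∀ {n t y} → e ≤ n → output e n (suc t) ≡ π y 0 → π n 0 ◁ y → value n t ◁ y
  -- Nothing follows `π n 0` within block `n`, since its second component is 0.
  value◁ {n} {t} {y} e≤n out (inj₂ (_ , p)) with subst (snd y <_) (snd-π n 0) p
  ... | ()
  value◁ {n} {t} {y} e≤n out (inj₁ p) rewrite m≤n⇒m∸n≡0 e≤n
    with m≤n⇒m<n∨m≡n (subst (_< fst y) (fst-π n 0) p)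
  ... | inj₁ q = inj₁ (subst (_< fst y) (sym (fst-π (suc n) _)) q)
  -- Here `y` lies in block `n + 1` too. Larger second components come first, and that of the value
  -- exceeds the output `π y 0`, hence `snd y`.
  ... | inj₂ q = inj₂ (trans (fst-π (suc n) _) q , subst (snd y <_) (sym (snd-π (suc n) _)) (s≤s (begin
      snd y                          ≤⟨ snd-≤ y ⟩
      y                              ≤⟨ m≤πmn y 0 ⟩
      π y 0                          ≡⟨ out ⟨
      output e n (suc t)             ≤⟨ n≤πmn t _ ⟩
      π t (output e n (suc t))       ≤⟨ n≤πmn e _ ⟩
      π e (π t (output e n (suc t))) ∎)))
    where open ≤-Reasoning

-- Immediate successors distinguish the two orders

ωζη-successor : ∀ x → ∃ λ y → ωζη-lt x y × ¬ (∃ λ z → ωζη-lt x z × ωζη-lt z y)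
ωζη-successor (inj₁ m) = inj₁ (suc m) , n<1+n m , none
  where
  none : ¬ (∃ λ z → ωζη-lt (inj₁ m) z × ωζη-lt z (inj₁ (suc m)))
  none (inj₁ k , m<k , s≤s k≤m) = <⇒≱ m<k k≤m
ωζη-successor (inj₂ (q , a)) = inj₂ (q , ℤ.suc a) , inj₂ (refl , ℤ.≤∧≢⇒< (ℤ.i≤suc[i] a) ℤ.i≢suc[i]) , none
  where
  none : ¬ (∃ λ z → ωζη-lt (inj₂ (q , a)) z × ωζη-lt z (inj₂ (q , ℤ.suc a)))
  none (inj₂ (r , b) , inj₁ q<r , inj₁ r<q)                = ℚ.<-asym q<r r<q
  none (inj₂ (r , b) , inj₁ q<r , inj₂ (refl , _))         = ℚ.<-irrefl refl q<r
  none (inj₂ (r , b) , inj₂ (refl , _) , inj₁ r<q)         = ℚ.<-irrefl refl r<q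
  none (inj₂ (r , b) , inj₂ (refl , a<b) , inj₂ (_ , b<1+a)) =
    ℤ.<-irrefl refl (ℤ.<-≤-trans b<1+a (ℤ.i<j⇒suc[i]≤j a<b))

hasSuccessors : Sentence
hasSuccessors = ∀′ (∃′ (((# 1) ⋖ (# 0)) ∧′ (¬′ (∃′ (((# 2) ⋖ (# 0)) ∧′ ((# 0) ⋖ (# 1)))))))

ω+ζη⊨hasSuccessors : OmegaZetaEta ⊨ hasSuccessors
ω+ζη⊨hasSuccessors = ωζη-successor

power⊭hasSuccessors : ∀ C → ¬ (CohesivePower C 𝓛 ⊨ hasSuccessors)
power⊭hasSuccessors C h = refute (h baseElement)
  where
  open OrdStructure (CohesivePower C 𝓛) renaming (_<_ to _<ᶜ_)

  baseElement : Carrier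
  baseElement = code baseF , (0 , λ x _ _ → _ , halts baseF (x ∷ []))
    , λ { x y p → subst InL (Halts⇒fn baseF p) (subst InL (sym (baseF-fn x)) (Element⇒InL (base x))) }

  refute : ¬ (∃ λ y → (baseElement <ᶜ y) × ¬ (∃ λ z → (baseElement <ᶜ z) × (z <ᶜ y)))
  refute ((c , c-dom , c-InL) , (N , base<c) , none) = none (z , (N′ , base<z) , (N′ , z<c))
    where
    e : ℕ
    -- The machine used against a candidate successor `c` is the one that computes `c` itself.
    e = ⌜ compile c ⌝

    open Between e

    N′ : ℕ
    -- From `N` on, the base element lies below the value of `c`; from `e` on, machine `e` is among
    -- those of block `n + 1`.
    N′ = N ⊔ e

    data Situation (n : ℕ) : Set where
      situation : ∀ {y t} → c ⟨ n ⟩≃ y → Halts (Mu (code haltedF)) (n ∷ []) t →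
                  value n t ◁ y → Situation n

    situated : ∀ n → N′ ≤ n → C n → Situation n
    situated n N′≤n n∈C with base<c n (≤-trans (m≤m⊔n N e) N′≤n) n∈C
    ... | u , y , base≃u , c≃y , u≺y with compile-halts c c≃y
    ... | t₀ , halted₀ , output₀ = locate t₀ halted₀ output₀
      where
      base◁y : π n 0 ◁ y
      base◁y = subst (_◁ y) (trans (sym (Halts⇒fn baseF base≃u)) (baseF-fn n)) (≺⇒◁ {u} {y} u≺y)

      -- `t₀` is some halting time, whereas the inserted element records the first one. The output
      -- is stable from there on, so it is `π y 0` at both times.
      locate : ∀ t₀ → todo e n t₀ ≡ 0 → output e n t₀ ≡ π y 0 → Situation n
      locate zero     halted₀ _       = ⊥-elim (todo-zero e n halted₀)
      locate (suc t₁) halted₀ output₀ with search-halts {n} {t₁} halted₀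
      ... | t , ht with search-halts⁻ ht
      ... | busy , halted = situation c≃y ht (value◁ (≤-trans (m≤n⊔m N e) N′≤n)
        (trans (sym (output-stable t<t₀ halted)) output₀) base◁y)
        where
        t<t₀ : t < suc t₁
        t<t₀ = ≰⇒> λ t₀≤t → busy (todo-stable t₀≤t halted₀)

    between-Dom : ∀ n → N′ ≤ n → C n → Dom between n
    between-Dom n p n∈C with situated n p n∈C
    ... | situation {t = t} _ ht _ = value n t , between-halts ht

    z : Carrier
    z = between , (N′ , between-Dom) , between-InL

    base<z : ∀ n → N′ ≤ n → C n → _
    base<z n p n∈C with situated n p n∈C
    ... | situation {t = t} _ ht _ =
      π n 0 , value n t , fn⇒Halts baseF (baseF-fn n) , between-halts ht , ◁⇒≺ (base◁value n t)

    z<c : ∀ n → N′ ≤ n → C n → _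
    z<c n p n∈C with situated n p n∈C
    ... | situation {y} {t} c≃y ht v◁y = value n t , y , between-halts ht , c≃y , ◁⇒≺ v◁y

theorem4p9 : (C : Subset) → Cohesive C →
    Σ CompOrder (λ L → OrderTypeω L × ¬ ElemEquiv (CohesivePower C L) OmegaZetaEta)
theorem4p9 C C-cohesive = 𝓛 , 𝓛-OrderTypeω C-cohesive ,
  λ equiv → power⊭hasSuccessors C (proj₂ (equiv hasSuccessors) ω+ζη⊨hasSuccessors)
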